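{- Let $(P_n,\beta)$ be the edge-labeled path graph with vertices $v_1,\dots,v_n$ (in this order along the path), module $m_j\mathbb{Z}$ at $v_j$ and module $\mathbb{Z}/r_k\mathbb{Z}$ at the edge $v_kv_{k+1}$, where $m_1,\dots,m_n,r_1,\dots,r_{n-1}\in\mathbb{Z}$; set $r_0=1$. Let $B=\{F^{(1)},\dots,F^{(n)}\}$ be a set of flow-up classes, where each $F^{(i)}=(0,\dots,0,f^{(i)}_{v_i},\dots,f^{(i)}_{v_n})\in\hat{\mathcal{F}}_i$ is minimal with first nonzero entry $$f^{(i)}_{v_i}=[m_i,r_{i-1},(m_{i+1},r_i),(m_{i+2},r_i,r_{i+1}),\dots,(m_n,r_i,r_{i+1},\dots,r_{n-1})]$$ for $i=1,2,\dots,n$. Then $B$ forms a module basis over $\mathbb{Z}$ for the module $\hat{R}_{P_n}$ of splines on $(P_n,\beta)$.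
   Context: Notation: $(\ )$ denotes the greatest common divisor and $[\ ]$ the least common multiple of integers. A spline on $(P_n,\beta)$ is a tuple $(f_{v_1},\dots,f_{v_n})$ of integers with $f_{v_j}\in m_j\mathbb{Z}$ for all $j$ and $f_{v_k}\equiv f_{v_{k+1}}\pmod{r_k}$ for $k=1,\dots,n-1$; the $\mathbb{Z}$-module of all splines is $\hat{R}_{P_n}$. An $i$-th flow-up class is a spline with $f_{v_i}\neq0$ and $f_{v_s}=0$ for all $s<i$; the set of these is $\hat{\mathcal{F}}_i$. The leading term of a flow-up class $F^{(i)}\in\hat{\mathcal{F}}_i$ is its first nonzero entry $f^{(i)}_{v_i}$; the leading terms of elements of $\hat{\mathcal{F}}_i$ (together with $0$) form an ideal $LT(\hat{\mathcal{F}}_i)$ of $\mathbb{Z}$, and $F^{(i)}$ is called minimal if its leading term generates this ideal. -}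

module Defs where

open import Algebra.Bundles using (CommutativeRing)
open import Algebra.Module.Bundles using (Module)
open import Algebra.Module.Structures.Biased using (IsModuleFromLeft)
import Algebra.Definitions.RawMonoid as RawMonoidSum
open import Data.Fin.Base as Fin using (Fin; toℕ; inject₁)
import Data.Fin.Properties as Fin
open import Data.Integer.Base using (ℤ; _+_; _*_; -_; _-_; 0ℤ; 1ℤ)
open import Data.Integer.Divisibility.Signed
  using (_∣_; divides; ∣m∣n⇒∣m+n; ∣m⇒∣-m; ∣n⇒∣m*n)
open import Data.Integer.GCD using (gcd)
open import Data.Integer.LCM using (lcm)
open import Data.Integer.Properties as ℤ using (+-*-commutativeRing)
open import Data.Integer.Tactic.RingSolver using (solve-∀)
open import Data.List.Base as List using (List; foldr; filter; map; allFin)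
open import Data.Nat.Base using (ℕ; suc)
import Data.Nat.Properties as ℕ
open import Data.Product.Base using (Σ; ∃; _×_; _,_)
open import Data.Sum.Base using (_⊎_)
open import Data.Vec.Functional using (Vector; _∷_)
open import Function.Bundles using (_⇔_)
open import Level using (0ℓ)
open import Relation.Binary.PropositionalEquality
  using (_≡_; _≢_; _≗_; refl; sym; trans; cong; cong₂; subst)
open import Relation.Nullary.Decidable using (_×-dec_)

module _ {c ℓ a ℓa} {R : CommutativeRing c ℓ} (M : Module R a ℓa) where
  private module R = CommutativeRing R
  open Module M using (Carrierᴹ; _≈ᴹ_; _*ₗ_; 0ᴹ; +ᴹ-rawMonoid)

  linearCombination : ∀ {k} → Vector R.Carrier k → Vector Carrierᴹ k → Carrierᴹ
  linearCombination x v = RawMonoidSum.sum +ᴹ-rawMonoid (λ i → x i *ₗ v i)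

  LinearlyIndependent : ∀ {k} → Vector Carrierᴹ k → Set _
  LinearlyIndependent v =
    ∀ x → linearCombination x v ≈ᴹ 0ᴹ → ∀ i → x i R.≈ R.0#

  Spans : ∀ {k} → Vector Carrierᴹ k → Set _
  Spans v = ∀ y → ∃ λ x → y ≈ᴹ linearCombination x v

  IsBasis : ∀ {k} → Vector Carrierᴹ k → Set _
  IsBasis v = LinearlyIndependent v × Spans v

infix 4 _≡_[mod_]

_≡_[mod_] : ℤ → ℤ → ℤ → Set
a ≡ b [mod r ] = r ∣ a - b

gcds lcms : List ℤ → ℤ
gcds = foldr gcd 0ℤ
lcms = foldr lcm 1ℤ

-- The path with suc n vertices and n edges, numbered from 0.  Edge k joins
-- the vertices inject₁ k and suc k, so the vertex v_j and the edge v_k v_{k+1}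
-- of the 1-based notation have indices j - 1 and k - 1.
record LabelledPath (n : ℕ) : Set where
  field
    m : Vector ℤ (suc n)
    r : Vector ℤ n

module _ {n : ℕ} (P : LabelledPath n) where
  open LabelledPath P

  record Spline : Set where
    field
      value  : Vector ℤ (suc n)
      vertex : ∀ j → m j ∣ value j
      edge   : ∀ k → value (inject₁ k) ≡ value (Fin.suc k) [mod r k ]

  open Spline

  private
    infixl 6 _+ˢ_
    infixr 7 _*ˢ_

    _≈ˢ_ : Spline → Spline → Set
    f ≈ˢ g = value f ≗ value g

    0ˢ : Spline
    0ˢ = record
      { value  = λ _ → 0ℤ
      ; vertex = λ _ → divides 0ℤ refl
      ; edge   = λ _ → divides 0ℤ refl
      }

    _+ˢ_ : Spline → Spline → Spline
    f +ˢ g = record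
      { value  = λ j → value f j + value g j
      ; vertex = λ j → ∣m∣n⇒∣m+n (vertex f j) (vertex g j)
      ; edge   = λ k → subst (r k ∣_)
                         (eq (value f (inject₁ k)) (value f (Fin.suc k))
                             (value g (inject₁ k)) (value g (Fin.suc k)))
                         (∣m∣n⇒∣m+n (edge f k) (edge g k))
      }
      where
      eq : ∀ a b c d → (a - b) + (c - d) ≡ (a + c) - (b + d)
      eq = solve-∀

    -ˢ_ : Spline → Spline
    -ˢ f = record
      { value  = λ j → - value f j
      ; vertex = λ j → ∣m⇒∣-m (vertex f j)
      ; edge   = λ k → subst (r k ∣_)
                         (eq (value f (inject₁ k)) (value f (Fin.suc k)))
                         (∣m⇒∣-m (edge f k))
      }
      where
      eq : ∀ a b → - (a - b) ≡ - a - - b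
      eq = solve-∀

    _*ˢ_ : ℤ → Spline → Spline
    x *ˢ f = record
      { value  = λ j → x * value f j
      ; vertex = λ j → ∣n⇒∣m*n x (vertex f j)
      ; edge   = λ k → subst (r k ∣_)
                         (eq x (value f (inject₁ k)) (value f (Fin.suc k)))
                         (∣n⇒∣m*n x (edge f k))
      }
      where
      eq : ∀ x a b → x * (a - b) ≡ x * a - x * b
      eq = solve-∀

  splineModule : Module +-*-commutativeRing 0ℓ 0ℓ
  splineModule = record
    { Carrierᴹ = Spline
    ; _≈ᴹ_     = _≈ˢ_
    ; _+ᴹ_     = _+ˢ_
    ; _*ₗ_     = _*ˢ_
    ; _*ᵣ_     = λ f x → x *ˢ f
    ; 0ᴹ       = 0ˢ
    ; -ᴹ_      = -ˢ_
    ; isModule = IsModuleFromLeft.isModule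
                   {commutativeRing = +-*-commutativeRing} (record
      { isLeftModule = record
        { isLeftSemimodule = record
          { +ᴹ-isCommutativeMonoid = record
            { isMonoid = record
              { isSemigroup = record
                { isMagma = record
                  { isEquivalence = record
                    { refl  = λ _ → refl
                    ; sym   = λ p j → sym (p j)
                    ; trans = λ p q j → trans (p j) (q j)
                    }
                  ; ∙-cong = λ p q j → cong₂ _+_ (p j) (q j)
                  }
                ; assoc = λ f g h j → ℤ.+-assoc (value f j) (value g j) (value h j)
                }
              ; identity = (λ f j → ℤ.+-identityˡ (value f j))
                         , (λ f j → ℤ.+-identityʳ (value f j))
              }
            ; comm = λ f g j → ℤ.+-comm (value f j) (value g j)
            }
          ; isPreleftSemimodule = record
            { *ₗ-cong      = λ p q j → cong₂ _*_ p (q j)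
            ; *ₗ-zeroˡ     = λ f j → ℤ.*-zeroˡ (value f j)
            ; *ₗ-distribʳ  = λ f x y j → ℤ.*-distribʳ-+ (value f j) x y
            ; *ₗ-identityˡ = λ f j → ℤ.*-identityˡ (value f j)
            ; *ₗ-assoc     = λ x y f j → ℤ.*-assoc x y (value f j)
            ; *ₗ-zeroʳ     = λ x j → ℤ.*-zeroʳ x
            ; *ₗ-distribˡ  = λ x f g j → ℤ.*-distribˡ-+ x (value f j) (value g j)
            }
          }
        ; -ᴹ‿cong    = λ p j → cong -_ (p j)
        ; -ᴹ‿inverse = (λ f j → ℤ.+-inverseˡ (value f j))
                     , (λ f j → ℤ.+-inverseʳ (value f j))
        }
      })
    }

  FlowUp : Fin (suc n) → Spline → Set
  FlowUp i f = value f i ≢ 0ℤ × (∀ s → s Fin.< i → value f s ≡ 0ℤ)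

  -- Leading terms of the i-th flow-up classes, together with 0.
  LT : Fin (suc n) → ℤ → Set
  LT i x = x ≡ 0ℤ ⊎ Σ Spline λ f → FlowUp i f × value f i ≡ x

  -- The last component says that LT i is the principal ideal generated by the
  -- leading term of f.
  Minimal : Fin (suc n) → Spline → Set
  Minimal i f = FlowUp i f × (∀ x → LT i x ⇔ value f i ∣ x)

  -- The edges on the subpath from vertex i to vertex j: those k with i ≤ k < j.
  edgesBetween : Fin (suc n) → Fin (suc n) → List (Fin n)
  edgesBetween i j =
    filter (λ k → (toℕ i ℕ.≤? toℕ k) ×-dec (toℕ k ℕ.<? toℕ j)) (allFin n)

  -- The label of the edge preceding vertex i, with r₀ = 1 before the first one.
  rBefore : Vector ℤ (suc n)
  rBefore = 1ℤ ∷ r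

  -- [ m_i , r_{i-1} , (m_{i+1}, r_i) , … , (m_n, r_i, …, r_{n-1}) ]
  leadingEntry : Fin (suc n) → ℤ
  leadingEntry i = lcms
    (m i List.∷ rBefore i List.∷
     map (λ j → gcds (m j List.∷ map r (edgesBetween i j)))
         (filter (i Fin.<?_) (allFin (suc n))))

{-# OPTIONS --safe #-}

-- Minimality makes the family triangular with diagonal entries that divide
-- everything which can occur there: a spline vanishing before v_i has its
-- entry at v_i divisible by that of F⁽ⁱ⁾, so subtracting a multiple of F⁽ⁱ⁾
-- clears it.  Clearing v₁, v₂, … in turn shows spanning, and nonzero diagonal
-- entries give independence.
module Submission where

open import Defs
open import Algebra.Bundles using (CommutativeMonoid; CommutativeRing)
open import Algebra.Module.Bundles using (Module)
import Algebra.Properties.CommutativeMonoid.Sum as CommutativeMonoidSum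
import Algebra.Properties.CommutativeSemigroup as CommutativeSemigroupProperties
open import Data.Fin.Base as Fin using (Fin; toℕ; inject₁; punchIn)
open import Data.Fin.Induction using (<-wellFounded; >-weakInduction)
open import Data.Fin.Properties as Fin using (punchInᵢ≢i)
open import Data.Integer.Base using (ℤ; _+_; _*_; -_; 0ℤ)
open import Data.Integer.Divisibility.Signed using (_∣_; divides)
open import Data.Integer.Properties as ℤ using (+-0-commutativeMonoid)
open import Data.Integer.Tactic.RingSolver using (solve-∀)
open import Data.Nat.Base as ℕ using (ℕ; zero; suc)
import Data.Nat.Properties as ℕ
open import Data.Product.Base using (∃; _,_; proj₁; proj₂)
open import Data.Sum.Base using (inj₁; inj₂; [_,_]′)
open import Data.Vec.Functional using (Vector; updateAt)
open import Function.Base using (_∘_; id)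
open import Function.Bundles using (Equivalence)
open import Induction.WellFounded using (module All)
open import Level using (0ℓ)
open import Relation.Binary.Definitions using (tri<; tri≈; tri>)
open import Relation.Binary.PropositionalEquality
  using (_≡_; _≢_; refl; sym; trans; cong; cong₂; subst; module ≡-Reasoning)
open import Relation.Nullary.Decidable using (yes; no)
open import Relation.Nullary.Negation using (contradiction)

module _ {c ℓ} (M : CommutativeMonoid c ℓ) where
  open CommutativeMonoid M renaming (refl to ≈-refl; trans to ≈-trans)
  open CommutativeMonoidSum M using (sum; sum-remove; sum-cong-≋; sum-replicate-zero)

  sum-isolate : ∀ {k} (t : Vector Carrier k) i →
    (∀ j → j ≢ i → t j ≈ ε) → sum t ≈ t i
  sum-isolate {suc k} t i t≈ε =
    ≈-trans (sum-remove {i = i} t)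
      (≈-trans
        (∙-congˡ (≈-trans (sum-cong-≋ λ j → t≈ε (punchIn i j) (punchInᵢ≢i i j))
                          (sum-replicate-zero k)))
        (identityʳ (t i)))

module _ {c ℓ a ℓa} {R : CommutativeRing c ℓ} (M : Module R a ℓa) where
  private module R = CommutativeRing R
  open Module M

  InSpan : ∀ {k} → Vector Carrierᴹ k → Carrierᴹ → Set _
  InSpan v y = ∃ λ x → y ≈ᴹ linearCombination M x v

  InSpan-resp-≈ : ∀ {k} (v : Vector Carrierᴹ k) {y z} → y ≈ᴹ z → InSpan v z → InSpan v y
  InSpan-resp-≈ v y≈z (x , z≈) = x , ≈ᴹ-trans y≈z z≈

  linearCombination-zero : ∀ {k} (v : Vector Carrierᴹ k) →
    linearCombination M (λ _ → R.0#) v ≈ᴹ 0ᴹ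
  linearCombination-zero {zero}  v = ≈ᴹ-refl
  linearCombination-zero {suc k} v =
    ≈ᴹ-trans (+ᴹ-cong (*ₗ-zeroˡ (v Fin.zero)) (linearCombination-zero (v ∘ Fin.suc)))
             (+ᴹ-identityˡ 0ᴹ)

  linearCombination-updateAt : ∀ {k} (x : Vector R.Carrier k) (v : Vector Carrierᴹ k) i q →
    linearCombination M (updateAt x i (q R.+_)) v ≈ᴹ q *ₗ v i +ᴹ linearCombination M x v
  linearCombination-updateAt x v Fin.zero q =
    ≈ᴹ-trans (+ᴹ-congʳ (*ₗ-distribʳ (v Fin.zero) q (x Fin.zero))) (+ᴹ-assoc _ _ _)
  linearCombination-updateAt x v (Fin.suc i) q =
    ≈ᴹ-trans (+ᴹ-congˡ (linearCombination-updateAt (x ∘ Fin.suc) (v ∘ Fin.suc) i q))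
             (x∙yz≈y∙xz _ _ _)
    where
    open CommutativeSemigroupProperties
      (CommutativeMonoid.commutativeSemigroup +ᴹ-commutativeMonoid) using (x∙yz≈y∙xz)

  InSpan-0 : ∀ {k} (v : Vector Carrierᴹ k) → InSpan v 0ᴹ
  InSpan-0 v = (λ _ → R.0#) , ≈ᴹ-sym (linearCombination-zero v)

  -- Undoes one clearing step: whatever multiple of `v i` was removed is put back by raising the
  -- coefficient of `v i` by `q`.
  InSpan-*+ : ∀ {k} (v : Vector Carrierᴹ k) i q {y} → InSpan v y → InSpan v (q *ₗ v i +ᴹ y)
  InSpan-*+ v i q (x , y≈) =
    updateAt x i (q R.+_) ,
    ≈ᴹ-trans (+ᴹ-congˡ y≈) (≈ᴹ-sym (linearCombination-updateAt x v i q))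

module _ {n : ℕ} (P : LabelledPath n) where
  open Spline
  open CommutativeMonoidSum +-0-commutativeMonoid using (sum)
  open Module (splineModule P) using (_+ᴹ_; _*ₗ_; 0ᴹ)

  value-linearCombination : ∀ {k} (x : Vector ℤ k) (v : Vector (Spline P) k) j →
    value (linearCombination (splineModule P) x v) j ≡ sum (λ i → x i * value (v i) j)
  value-linearCombination {zero}  x v j = refl
  value-linearCombination {suc k} x v j =
    cong (x Fin.zero * value (v Fin.zero) j +_)
         (value-linearCombination (x ∘ Fin.suc) (v ∘ Fin.suc) j)

  -- The bound is a natural number so that it can also be `suc n`, one past the last vertex.
  VanishesBefore : ℕ → Spline P → Set
  VanishesBefore k f = ∀ s → toℕ s ℕ.< k → value f s ≡ 0ℤ

  -- Either the entry of `g` at `i` is zero, or `g` is itself an `i`-th flow-up class. In both cases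
  -- the entry lies in `LT P i`, and minimality says that this ideal consists of the multiples of
  -- `value f i`.
  minimal⇒∣ : ∀ i f → Minimal P i f →
    ∀ g → VanishesBefore (toℕ i) g → value f i ∣ value g i
  minimal⇒∣ i f (_ , LT⇔) g g≡0 = Equivalence.to (LT⇔ (value g i)) leading
    where
    leading : LT P i (value g i)
    leading with value g i ℤ.≟ 0ℤ
    ... | yes gi≡0 = inj₁ gi≡0
    ... | no  gi≢0 = inj₂ (g , (gi≢0 , g≡0) , refl)

  -- Strong induction on the vertex. In the entry at `i` of a vanishing combination, the terms
  -- before `i` vanish by the induction hypothesis and those after `i` because their classes start
  -- later. What is left is `x i` times a nonzero integer.
  flowUp⇒linearlyIndependent : (F : Vector (Spline P) (suc n)) →
    (∀ i → FlowUp P i (F i)) → LinearlyIndependent (splineModule P) F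
  flowUp⇒linearlyIndependent F flowUp x lc≡0 =
    All.wfRec <-wellFounded 0ℓ (λ i → x i ≡ 0ℤ) step
    where
    open ≡-Reasoning
    step : ∀ i → (∀ {s} → s Fin.< i → x s ≡ 0ℤ) → x i ≡ 0ℤ
    step i x≡0 = [ id , (λ Fii≡0 → contradiction Fii≡0 (proj₁ (flowUp i))) ]′
      (ℤ.i*j≡0⇒i≡0∨j≡0 (x i) product≡0)
      where
      others : ∀ t → t ≢ i → x t * value (F t) i ≡ 0ℤ
      others t t≢i with Fin.<-cmp t i
      ... | tri< t<i _ _ = cong (_* value (F t) i) (x≡0 t<i)
      ... | tri≈ _ t≡i _ = contradiction t≡i t≢i
      ... | tri> _ _ i<t = trans (cong (x t *_) (proj₂ (flowUp t) i i<t)) (ℤ.*-zeroʳ (x t))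

      product≡0 : x i * value (F i) i ≡ 0ℤ
      product≡0 = begin
        x i * value (F i) i
          ≡⟨ sum-isolate +-0-commutativeMonoid (λ t → x t * value (F t) i) i others ⟨
        sum (λ t → x t * value (F t) i)
          ≡⟨ value-linearCombination x F i ⟨
        value (linearCombination (splineModule P) x F) i
          ≡⟨ lc≡0 i ⟩
        0ℤ ∎

  minimal⇒spans : (F : Vector (Spline P) (suc n)) →
    (∀ i → Minimal P i (F i)) → Spans (splineModule P) F
  -- The induction runs from `suc n` down to 0, where vanishing before 0 is vacuous and so `y` is
  -- arbitrary.
  minimal⇒spans F minimal y = >-weakInduction Spanned base step Fin.zero y (λ _ ())
    where
    Spanned : Fin (suc (suc n)) → Set
    Spanned k = ∀ g → VanishesBefore (toℕ k) g → InSpan (splineModule P) F g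

    base : Spanned (Fin.fromℕ (suc n))
    base g g≡0 = InSpan-resp-≈ (splineModule P) F {g} {0ᴹ}
      -- Every vertex lies below `suc n`, so `g` is the zero spline.
      (λ s → g≡0 s (subst (toℕ s ℕ.<_) (sym (Fin.toℕ-fromℕ (suc n))) (Fin.toℕ<n s)))
      (InSpan-0 (splineModule P) F)

    step : ∀ i → Spanned (Fin.suc i) → Spanned (inject₁ i)
    step i spanned g g≡0 = reduce (minimal⇒∣ i (F i) (minimal i) g g≡0ᵢ)
      where
      g≡0ᵢ : VanishesBefore (toℕ i) g
      g≡0ᵢ s = g≡0 s ∘ subst (toℕ s ℕ.<_) (sym (Fin.toℕ-inject₁ i))

      reduce : value (F i) i ∣ value g i → InSpan (splineModule P) F g
      reduce (divides q gi≡q*Fii) = InSpan-resp-≈ (splineModule P) F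
        {g} {q *ₗ F i +ᴹ remainder}
        (λ s → add-back q (value (F i) s) (value g s))
        (InSpan-*+ (splineModule P) F i q {remainder} (spanned remainder remainder≡0))
        where
        remainder : Spline P
        -- `q` is the quotient of the two entries at `i`, so the entry of `g` there is cancelled.
        remainder = (- q) *ₗ F i +ᴹ g

        add-back : ∀ q a b → b ≡ q * a + (- q * a + b)
        add-back = solve-∀

        cancel : ∀ q a → - q * a + q * a ≡ 0ℤ
        cancel = solve-∀

        remainder≡0 : VanishesBefore (suc (toℕ i)) remainder
        -- Before `i` both summands are zero, so clearing the entry at `i` spoils none of the
        -- earlier zeros; at `i` the choice of `q` makes them cancel.
        remainder≡0 s s<1+i with ℕ.m<1+n⇒m<n∨m≡n s<1+i
        ... | inj₁ s<i = cong₂ _+_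
          (trans (cong (- q *_) (proj₂ (proj₁ (minimal i)) s s<i)) (ℤ.*-zeroʳ (- q)))
          (g≡0ᵢ s s<i)
        ... | inj₂ s≡i with refl ← Fin.toℕ-injective s≡i =
          trans (cong (- q * value (F i) i +_) gi≡q*Fii) (cancel q (value (F i) i))

theorem5p4 : (n : ℕ) (P : LabelledPath n) (F : Vector (Spline P) (suc n)) →
    (∀ i → Minimal P i (F i)) →
    (∀ i → Spline.value (F i) i ≡ leadingEntry P i) →
    IsBasis (splineModule P) F
theorem5p4 n P F minimal _ =
  flowUp⇒linearlyIndependent P F (proj₁ ∘ minimal) , minimal⇒spans P F minimal
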